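{- The rule ($\rho9$): from $(\phi\rightsquigarrow p)\wedge(p\rightsquigarrow\psi)\wedge(p\rightsquigarrow p)\to\chi$ infer $(\phi\rightsquigarrow\psi)\to\chi$ (where $p$ is a propositional variable not occurring in $\phi,\psi,\chi$) is admissible in $\mathsf{MS^2IC}$: whenever the premise is a theorem of $\mathsf{MS^2IC}$ with $p$ not occurring in $\phi,\psi,\chi$, so is $(\phi\rightsquigarrow\psi)\to\chi$.
   Context: Language: propositional variables, $\top,\bot$, $\neg,\wedge,\vee,\to,\leftrightarrow$, a binary connective $\rightsquigarrow$ and a unary modality $\Box$; $\Diamond\phi:=\neg\Box\neg\phi$, $[\forall]\phi:=\top\rightsquigarrow\phi$. $\mathsf{MS^2IC}$: theorems are the least set containing all instances of classical tautologies and of (A1) $(\bot\rightsquigarrow\phi)\wedge(\phi\rightsquigarrow\top)$; (A2) $((\phi\vee\psi)\rightsquigarrow\chi)\leftrightarrow((\phi\rightsquigarrow\chi)\wedge(\psi\rightsquigarrow\chi))$; (A3) $(\phi\rightsquigarrow(\psi\wedge\chi))\leftrightarrow((\phi\rightsquigarrow\psi)\wedge(\phi\rightsquigarrow\chi))$; (A4) $(\phi\rightsquigarrow\psi)\to(\phi\to\psi)$; (A5) $(\phi\rightsquigarrow\psi)\leftrightarrow(\neg\psi\rightsquigarrow\neg\phi)$; (A8) $[\forall]\phi\to[\forall][\forall]\phi$; (A9) $\neg[\forall]\phi\to[\forall]\neg[\forall]\phi$; (A10) $(\phi\rightsquigarrow\psi)\leftrightarrow[\forall](\phi\rightsquigarrow\psi)$;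 (A11) $[\forall]\phi\to(\neg[\forall]\phi\rightsquigarrow\bot)$; (K) $\Box(\phi\to\psi)\to(\Box\phi\to\Box\psi)$; (Add) $(\phi\rightsquigarrow\psi)\to(\Box\phi\rightsquigarrow\Box\psi)$; closed under modus ponens, from $\phi$ infer $[\forall]\phi$, from $\phi$ infer $\Box\phi$. -}

module Defs where

open import Data.Nat using (ℕ)
open import Data.Bool using (Bool; true; false; not; _∧_; _∨_; if_then_else_)
open import Data.Product using (Σ; _×_)
open import Data.Empty using (⊥)
open import Data.Unit using (⊤)
open import Relation.Nullary using (¬_)
open import Relation.Binary.PropositionalEquality using (_≡_)

infixr 30 _⇝_
infixr 25 _∧'_
infixr 24 _∨'_
infixr 20 _⇒_
infix  19 _⇔_

data Form : Set where
  var  : ℕ → Form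
  ⊤'   : Form
  ⊥'   : Form
  ¬'_  : Form → Form
  _∧'_ : Form → Form → Form
  _∨'_ : Form → Form → Form
  _⇒_  : Form → Form → Form
  _⇔_  : Form → Form → Form
  _⇝_  : Form → Form → Form
  □_   : Form → Form

◇_ : Form → Form
◇ φ = ¬' (□ (¬' φ))

[∀]_ : Form → Form
[∀] φ = ⊤' ⇝ φ

data PForm : Set where
  pvar  : ℕ → PForm
  ptop  : PForm
  pbot  : PForm
  pneg  : PForm → PForm
  pand  : PForm → PForm → PForm
  por   : PForm → PForm → PForm
  pimp  : PForm → PForm → PForm
  piff  : PForm → PForm → PForm

evalP : (ℕ → Bool) → PForm → Bool
evalP v (pvar n)   = v n
evalP v ptop       = true
evalP v pbot       = false
evalP v (pneg a)   = not (evalP v a)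
evalP v (pand a b) = evalP v a ∧ evalP v b
evalP v (por a b)  = evalP v a ∨ evalP v b
evalP v (pimp a b) = not (evalP v a) ∨ evalP v b
evalP v (piff a b) = if evalP v a then evalP v b else not (evalP v b)

Tautology : PForm → Set
Tautology τ = (v : ℕ → Bool) → evalP v τ ≡ true

inst : (ℕ → Form) → PForm → Form
inst σ (pvar n)   = σ n
inst σ ptop       = ⊤'
inst σ pbot       = ⊥'
inst σ (pneg a)   = ¬' inst σ a
inst σ (pand a b) = inst σ a ∧' inst σ b
inst σ (por a b)  = inst σ a ∨' inst σ b
inst σ (pimp a b) = inst σ a ⇒ inst σ b
inst σ (piff a b) = inst σ a ⇔ inst σ b

TautInstance : Form → Set
TautInstance φ = Σ PForm λ τ → Σ (ℕ → Form) λ σ → Tautology τ × (inst σ τ ≡ φ)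

data ⊢_ : Form → Set where
  taut : ∀ {φ} → TautInstance φ → ⊢ φ
  A1   : ∀ φ → ⊢ ((⊥' ⇝ φ) ∧' (φ ⇝ ⊤'))
  A2   : ∀ φ ψ χ → ⊢ (((φ ∨' ψ) ⇝ χ) ⇔ ((φ ⇝ χ) ∧' (ψ ⇝ χ)))
  A3   : ∀ φ ψ χ → ⊢ ((φ ⇝ (ψ ∧' χ)) ⇔ ((φ ⇝ ψ) ∧' (φ ⇝ χ)))
  A4   : ∀ φ ψ → ⊢ ((φ ⇝ ψ) ⇒ (φ ⇒ ψ))
  A5   : ∀ φ ψ → ⊢ ((φ ⇝ ψ) ⇔ ((¬' ψ) ⇝ (¬' φ)))
  A8   : ∀ φ → ⊢ (([∀] φ) ⇒ ([∀] ([∀] φ)))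
  A9   : ∀ φ → ⊢ ((¬' ([∀] φ)) ⇒ ([∀] (¬' ([∀] φ))))
  A10  : ∀ φ ψ → ⊢ ((φ ⇝ ψ) ⇔ ([∀] (φ ⇝ ψ)))
  A11  : ∀ φ → ⊢ (([∀] φ) ⇒ ((¬' ([∀] φ)) ⇝ ⊥'))
  K    : ∀ φ ψ → ⊢ ((□ (φ ⇒ ψ)) ⇒ ((□ φ) ⇒ (□ ψ)))
  Add  : ∀ φ ψ → ⊢ ((φ ⇝ ψ) ⇒ ((□ φ) ⇝ (□ ψ)))
  MP   : ∀ {φ ψ} → ⊢ (φ ⇒ ψ) → ⊢ φ → ⊢ ψ
  NecA : ∀ {φ} → ⊢ φ → ⊢ ([∀] φ)
  NecB : ∀ {φ} → ⊢ φ → ⊢ (□ φ)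

_∉v_ : ℕ → Form → Set
p ∉v var n   = ¬ (p ≡ n)
p ∉v ⊤'      = ⊤
p ∉v ⊥'      = ⊤
p ∉v (¬' a)  = p ∉v a
p ∉v (a ∧' b) = p ∉v a × p ∉v b
p ∉v (a ∨' b) = p ∉v a × p ∉v b
p ∉v (a ⇒ b)  = p ∉v a × p ∉v b
p ∉v (a ⇔ b)  = p ∉v a × p ∉v b
p ∉v (a ⇝ b)  = p ∉v a × p ∉v b
p ∉v (□ a)    = p ∉v a

{-# OPTIONS --safe #-}
-- Replacement of provable equivalents under ⇝ is not among the rules and fails
-- (⊤ ⇝ q does not yield (⊤ ∧ ⊤) ⇝ q), so ⇝ is no operation on the Lindenbaum
-- algebra and extending a contact algebra by an interpolant is not an option.
-- Instead, the proof is a translation t preserving ⊢, fixing the p-free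
-- formulas and sending p to ψ.  On a formula α ⇝ β in which p occurs, t splits
-- disjunctions in α and conjunctions in β, contraposes pairs of negations,
-- sends □α ⇝ □β to the translation of α ⇝ β, and sends p ⇝ β to [∀](ψ ⇒ t β);
-- any other α ⇝ β goes to t α ⇝ t β.  Then p ⇝ ψ and p ⇝ p become theorems,
-- while φ ⇝ p becomes φ ⇝ ψ up to A2.
module Submission where

open import Defs
open import Data.Nat using (ℕ; zero; suc; _≟_)
open import Data.Bool using (Bool; true; false; _∧_)
open import Data.Bool.Properties using (∧-conicalˡ; ∧-conicalʳ)
open import Data.Empty using (⊥-elim)
open import Data.Fin using (toℕ)
open import Data.Product using (_,_; _×_)
open import Data.Unit using (tt)
open import Data.Vec using (Vec; []; _∷_; tabulate)
open import Data.Nat.Properties using (≟-diag)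
open import Function using (_∘_)
open import Relation.Binary.PropositionalEquality
  using (_≡_; refl; sym; trans; cong; cong₂; subst; subst₂)
open import Relation.Nullary using (Dec; yes; no; ¬_; ¬?; _×-dec_)

-- Truth tables

-- Evaluates to `true` on concrete formulas, so each tautology below is checked by `refl`.
every : ∀ n → (Vec Bool n → Bool) → Bool
every zero    P = P []
every (suc n) P = every n (P ∘ (true ∷_)) ∧ every n (P ∘ (false ∷_))

every-sound : ∀ n P → every n P ≡ true → ∀ bs → P bs ≡ true
every-sound zero    P h []           = h
every-sound (suc n) P h (true  ∷ bs) =
  every-sound n _ (∧-conicalˡ _ (every n (P ∘ (false ∷_))) h) bs
every-sound (suc n) P h (false ∷ bs) =
  every-sound n _ (∧-conicalʳ (every n (P ∘ (true ∷_))) _ h) bs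

assign : ∀ {A : Set} {n} → A → Vec A n → ℕ → A
assign d []       _       = d
assign d (x ∷ xs) zero    = x
assign d (x ∷ xs) (suc i) = assign d xs i

-- The first hypothesis holds by refl when the variables of τ are among the first n.
truth-table : ∀ {n} τ →
  (∀ v → evalP (assign false (tabulate {n = n} (v ∘ toℕ))) τ ≡ evalP v τ) →
  every n (λ bs → evalP (assign false bs) τ) ≡ true →
  (as : Vec Form n) → ⊢ inst (assign ⊤' as) τ
truth-table {n} τ local h as =
  taut (τ , assign ⊤' as ,
        (λ v → trans (sym (local v)) (every-sound n _ h (tabulate (v ∘ toℕ)))) , refl)

-- Derived propositional rules

private
  x₀ x₁ x₂ x₃ x₄ : PForm
  x₀ = pvar 0
  x₁ = pvar 1
  x₂ = pvar 2
  x₃ = pvar 3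
  x₄ = pvar 4

⊤-intro : ⊢ ⊤'
⊤-intro = truth-table ptop (λ _ → refl) refl []

⇒-refl : ∀ {a} → ⊢ (a ⇒ a)
⇒-refl {a} = truth-table (pimp x₀ x₀) (λ _ → refl) refl (a ∷ [])

⇒-const : ∀ {a b} → ⊢ b → ⊢ (a ⇒ b)
⇒-const {a} {b} =
  MP (truth-table (pimp x₁ (pimp x₀ x₁)) (λ _ → refl) refl (a ∷ b ∷ []))

⇒-trans : ∀ {a b c} → ⊢ (a ⇒ b) → ⊢ (b ⇒ c) → ⊢ (a ⇒ c)
⇒-trans {a} {b} {c} h k = MP (MP (truth-table
  (pimp (pimp x₀ x₁) (pimp (pimp x₁ x₂) (pimp x₀ x₂)))
  (λ _ → refl) refl (a ∷ b ∷ c ∷ [])) h) k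

⇒-discharge : ∀ {a b c} → ⊢ (a ⇒ b ⇒ c) → ⊢ b → ⊢ (a ⇒ c)
⇒-discharge {a} {b} {c} h k = MP (MP (truth-table
  (pimp (pimp x₀ (pimp x₁ x₂)) (pimp x₁ (pimp x₀ x₂)))
  (λ _ → refl) refl (a ∷ b ∷ c ∷ [])) h) k

⇒-contrapose : ∀ {a b c} → ⊢ (a ⇒ b ⇒ c) → ⊢ (a ⇒ (¬' c) ⇒ (¬' b))
⇒-contrapose {a} {b} {c} = MP (truth-table
  (pimp (pimp x₀ (pimp x₁ x₂)) (pimp x₀ (pimp (pneg x₂) (pneg x₁))))
  (λ _ → refl) refl (a ∷ b ∷ c ∷ []))

∧-intro : ∀ {a b} → ⊢ a → ⊢ b → ⊢ (a ∧' b)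
∧-intro {a} {b} h k = MP (MP (truth-table
  (pimp x₀ (pimp x₁ (pand x₀ x₁))) (λ _ → refl) refl (a ∷ b ∷ [])) h) k

∧-projˡ : ∀ {a b} → ⊢ ((a ∧' b) ⇒ a)
∧-projˡ {a} {b} =
  truth-table (pimp (pand x₀ x₁) x₀) (λ _ → refl) refl (a ∷ b ∷ [])

∧-projʳ : ∀ {a b} → ⊢ ((a ∧' b) ⇒ b)
∧-projʳ {a} {b} =
  truth-table (pimp (pand x₀ x₁) x₁) (λ _ → refl) refl (a ∷ b ∷ [])

⇒-∧ : ∀ {a b c} → ⊢ (a ⇒ b) → ⊢ (a ⇒ c) → ⊢ (a ⇒ (b ∧' c))
⇒-∧ {a} {b} {c} h k = MP (MP (truth-table
  (pimp (pimp x₀ x₁) (pimp (pimp x₀ x₂) (pimp x₀ (pand x₁ x₂))))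
  (λ _ → refl) refl (a ∷ b ∷ c ∷ [])) h) k

∧-elim-∨ : ∀ {a b x y z} → ⊢ (a ⇒ x ⇒ z) → ⊢ (b ⇒ y ⇒ z) →
  ⊢ ((a ∧' b) ⇒ (x ∨' y) ⇒ z)
∧-elim-∨ {a} {b} {x} {y} {z} h k = MP (MP (truth-table
  (pimp (pimp x₀ (pimp x₂ x₄)) (pimp (pimp x₁ (pimp x₃ x₄))
    (pimp (pand x₀ x₁) (pimp (por x₂ x₃) x₄))))
  (λ _ → refl) refl (a ∷ b ∷ x ∷ y ∷ z ∷ [])) h) k

∧-elim-∧ : ∀ {a b x y z} → ⊢ (a ⇒ z ⇒ x) → ⊢ (b ⇒ z ⇒ y) →
  ⊢ ((a ∧' b) ⇒ z ⇒ (x ∧' y))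
∧-elim-∧ {a} {b} {x} {y} {z} h k = MP (MP (truth-table
  (pimp (pimp x₀ (pimp x₄ x₂)) (pimp (pimp x₁ (pimp x₄ x₃))
    (pimp (pand x₀ x₁) (pimp x₄ (pand x₂ x₃)))))
  (λ _ → refl) refl (a ∷ b ∷ x ∷ y ∷ z ∷ [])) h) k

⇔-refl : ∀ {a} → ⊢ (a ⇔ a)
⇔-refl {a} = truth-table (piff x₀ x₀) (λ _ → refl) refl (a ∷ [])

⇔-sym : ∀ {a b} → ⊢ (a ⇔ b) → ⊢ (b ⇔ a)
⇔-sym {a} {b} = MP (truth-table
  (pimp (piff x₀ x₁) (piff x₁ x₀)) (λ _ → refl) refl (a ∷ b ∷ []))

⇔-trans : ∀ {a b c} → ⊢ (a ⇔ b) → ⊢ (b ⇔ c) → ⊢ (a ⇔ c)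
⇔-trans {a} {b} {c} h k = MP (MP (truth-table
  (pimp (piff x₀ x₁) (pimp (piff x₁ x₂) (piff x₀ x₂)))
  (λ _ → refl) refl (a ∷ b ∷ c ∷ [])) h) k

⇔-to : ∀ {a b} → ⊢ (a ⇔ b) → ⊢ (a ⇒ b)
⇔-to {a} {b} = MP (truth-table
  (pimp (piff x₀ x₁) (pimp x₀ x₁)) (λ _ → refl) refl (a ∷ b ∷ []))

∧-cong : ∀ {a b c d} → ⊢ (a ⇔ b) → ⊢ (c ⇔ d) → ⊢ ((a ∧' c) ⇔ (b ∧' d))
∧-cong {a} {b} {c} {d} h k = MP (MP (truth-table
  (pimp (piff x₀ x₁) (pimp (piff x₂ x₃) (piff (pand x₀ x₂) (pand x₁ x₃))))
  (λ _ → refl) refl (a ∷ b ∷ c ∷ d ∷ [])) h) k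

∧-interchange : ∀ {a b c d} →
  ⊢ (((a ∧' b) ∧' (c ∧' d)) ⇔ ((a ∧' c) ∧' (b ∧' d)))
∧-interchange {a} {b} {c} {d} = truth-table
  (piff (pand (pand x₀ x₁) (pand x₂ x₃)) (pand (pand x₀ x₂) (pand x₁ x₃)))
  (λ _ → refl) refl (a ∷ b ∷ c ∷ d ∷ [])

[∀]⇒□ : ∀ a → ⊢ (([∀] a) ⇒ (□ a))
[∀]⇒□ a = ⇒-discharge (⇒-trans (Add ⊤' a) (A4 (□ ⊤') (□ a))) (NecB ⊤-intro)

-- The translation

module Translation (p : ℕ) (ψ : Form) where

  free? : ∀ α → Dec (p ∉v α)
  free? (var q)  = ¬? (p ≟ q)
  free? ⊤'       = yes tt
  free? ⊥'       = yes tt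
  free? (¬' α)   = free? α
  free? (α ∧' β) = free? α ×-dec free? β
  free? (α ∨' β) = free? α ×-dec free? β
  free? (α ⇒ β)  = free? α ×-dec free? β
  free? (α ⇔ β)  = free? α ×-dec free? β
  free? (α ⇝ β)  = free? α ×-dec free? β
  free? (□ α)    = free? α

  data View : Form → Form → Set where
    or-left   : ∀ α α' β → View (α ∨' α') β
    top       : ∀ β → View ⊤' β
    and-right : ∀ α β β' → View α (β ∧' β')
    negations : ∀ α β → View (¬' α) (¬' β)
    boxes     : ∀ α β → View (□ α) (□ β)
    fresh     : ∀ β → View (var p) β
    other     : ∀ α β → View α β

  -- The order of the clauses matters for want of replacement: t must keep
  -- ⊤ ⇝ β of the form [∀](t β) for A9, and split β before the clause for p,
  -- since [∀](ψ ⇒ (β ∧ β')) need not distribute over ∧.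
  view : ∀ α β → View α β
  view (α ∨' α') β         = or-left α α' β
  view ⊤'        β         = top β
  view α         (β ∧' β') = and-right α β β'
  view (¬' α)    (¬' β)    = negations α β
  view (□ α)     (□ β)     = boxes α β
  view (var q)   β with p ≟ q
  ... | yes refl = fresh β
  ... | no _     = other (var q) β
  view α         β         = other α β

  choose : ∀ {P : Set} → Dec P → Form → Form → Form
  choose (yes _) a b = a
  choose (no _)  a b = b

  mutual
    t : Form → Form
    t (var q)  = choose (p ≟ q) ψ (var q)
    t ⊤'       = ⊤'
    t ⊥'       = ⊥'
    t (¬' α)   = ¬' t α
    t (α ∧' β) = t α ∧' t β
    t (α ∨' β) = t α ∨' t β
    t (α ⇒ β)  = t α ⇒ t β
    t (α ⇔ β)  = t α ⇔ t β
    t (α ⇝ β)  = t⇝ α β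
    t (□ α)    = □ t α

    -- Testing for p first fixes p-free formulas literally; `split` alone would turn a p-free
    -- `(α ∨' α') ⇝ β` into a conjunction.
    t⇝ : Form → Form → Form
    t⇝ α β = choose (free? α ×-dec free? β) (α ⇝ β) (split α β)

    split : Form → Form → Form
    split α β with view α β
    ... | or-left α₁ α₂ _   = t⇝ α₁ β ∧' t⇝ α₂ β
    ... | top _             = ⊤' ⇝ t β
    ... | and-right _ β₁ β₂ = t⇝ α β₁ ∧' t⇝ α β₂
    ... | negations α₁ β₁   = t⇝ β₁ α₁
    ... | boxes α₁ β₁       = t⇝ α₁ β₁
    -- Not `ψ ⇝ t β`: at `β = var p` this would be `ψ ⇝ ψ`, in general no theorem, whereas
    -- `[∀] (ψ ⇒ ψ)` follows by `NecA`.
    ... | fresh _           = ⊤' ⇝ (ψ ⇒ t β)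
    ... | other _ _         = t α ⇝ t β

  -- Equations for the translation

  t⇝-free : ∀ {α β} → p ∉v α → p ∉v β → t⇝ α β ≡ α ⇝ β
  t⇝-free {α} {β} a b with free? α ×-dec free? β
  ... | yes _ = refl
  ... | no ¬f = ⊥-elim (¬f (a , b))

  t⇝-elim : ∀ (P : Form → Set) {α β} →
    (p ∉v α → p ∉v β → P (α ⇝ β)) → P (split α β) → P (t⇝ α β)
  t⇝-elim P {α} {β} f s with free? α ×-dec free? β
  ... | yes (a , b) = f a b
  ... | no _        = s

  t-p : t (var p) ≡ ψ
  t-p with p ≟ p
  ... | yes _  = refl
  ... | no p≢p = ⊥-elim (p≢p refl)

  t-free : ∀ α → p ∉v α → t α ≡ α
  t-free (var q) p≢q with p ≟ q
  ... | yes p≡q = ⊥-elim (p≢q p≡q)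
  ... | no _    = refl
  t-free ⊤'       _       = refl
  t-free ⊥'       _       = refl
  t-free (¬' α)   a       = cong ¬'_ (t-free α a)
  t-free (α ∧' β) (a , b) = cong₂ _∧'_ (t-free α a) (t-free β b)
  t-free (α ∨' β) (a , b) = cong₂ _∨'_ (t-free α a) (t-free β b)
  t-free (α ⇒ β)  (a , b) = cong₂ _⇒_ (t-free α a) (t-free β b)
  t-free (α ⇔ β)  (a , b) = cong₂ _⇔_ (t-free α a) (t-free β b)
  t-free (α ⇝ β)  (a , b) = t⇝-free a b
  t-free (□ α)    a       = cong □_ (t-free α a)

  t-inst : ∀ σ τ → t (inst σ τ) ≡ inst (t ∘ σ) τ
  t-inst σ (pvar n)   = refl
  t-inst σ ptop       = refl
  t-inst σ pbot       = refl
  t-inst σ (pneg a)   = cong ¬'_ (t-inst σ a)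
  t-inst σ (pand a b) = cong₂ _∧'_ (t-inst σ a) (t-inst σ b)
  t-inst σ (por a b)  = cong₂ _∨'_ (t-inst σ a) (t-inst σ b)
  t-inst σ (pimp a b) = cong₂ _⇒_ (t-inst σ a) (t-inst σ b)
  t-inst σ (piff a b) = cong₂ _⇔_ (t-inst σ a) (t-inst σ b)

  -- An equation rather than an equivalence, because `A8`, `A9` and `A11` have `[∀]` inside the
  -- scope of `⇝`.
  t-[∀] : ∀ β → t ([∀] β) ≡ [∀] (t β)
  t-[∀] β = t⇝-elim (_≡ [∀] (t β)) {⊤'} {β}
    (λ _ b → cong [∀]_ (sym (t-free β b))) refl

  -- A negation against `⊥'` falls under `other`, so the consequent of `A11` keeps its shape.
  t⇝-¬⊥ : ∀ α → t⇝ (¬' α) ⊥' ≡ (¬' t α) ⇝ ⊥'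
  t⇝-¬⊥ α = t⇝-elim (_≡ (¬' t α) ⇝ ⊥') {¬' α} {⊥'}
    (λ a _ → cong (λ x → (¬' x) ⇝ ⊥') (sym (t-free α a))) refl

  -- Preservation of axioms and rules

  mutual
    -- Translations are conjunctions of `⇝`-formulas: `A10` covers each conjunct, and `A3` with
    -- antecedent `⊤'` collects them under one `[∀]`.
    t⇝-global : ∀ α β → ⊢ (t⇝ α β ⇔ ([∀] t⇝ α β))
    t⇝-global α β =
      t⇝-elim (λ x → ⊢ (x ⇔ ([∀] x))) {α} {β} (λ _ _ → A10 α β) (split-global α β)

    split-global : ∀ α β → ⊢ (split α β ⇔ ([∀] split α β))
    split-global α β with view α β
    ... | or-left α₁ α₂ _   =
      ⇔-trans (∧-cong (t⇝-global α₁ β) (t⇝-global α₂ β)) (⇔-sym (A3 _ _ _))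
    ... | top _             = A10 _ _
    ... | and-right _ β₁ β₂ =
      ⇔-trans (∧-cong (t⇝-global α β₁) (t⇝-global α β₂)) (⇔-sym (A3 _ _ _))
    ... | negations α₁ β₁   = t⇝-global β₁ α₁
    ... | boxes α₁ β₁       = t⇝-global α₁ β₁
    ... | fresh _           = A10 _ _
    ... | other _ _         = A10 _ _

  t⇝⇒□ : ∀ α β → ⊢ (t⇝ α β ⇒ (□ t⇝ α β))
  t⇝⇒□ α β = ⇒-trans (⇔-to (t⇝-global α β)) ([∀]⇒□ _)

  mutual
    t⇝⇒⇒ : ∀ α β → ⊢ (t⇝ α β ⇒ t α ⇒ t β)
    t⇝⇒⇒ α β = t⇝-elim (λ x → ⊢ (x ⇒ t α ⇒ t β)) {α} {β}
      (λ a b → subst₂ (λ x y → ⊢ ((α ⇝ β) ⇒ x ⇒ y))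
        (sym (t-free α a)) (sym (t-free β b)) (A4 α β))
      (split⇒⇒ α β)

    split⇒⇒ : ∀ α β → ⊢ (split α β ⇒ t α ⇒ t β)
    split⇒⇒ α β with view α β
    ... | or-left α₁ α₂ _   = ∧-elim-∨ (t⇝⇒⇒ α₁ β) (t⇝⇒⇒ α₂ β)
    ... | top _             = A4 _ _
    ... | and-right _ β₁ β₂ = ∧-elim-∧ (t⇝⇒⇒ α β₁) (t⇝⇒⇒ α β₂)
    ... | negations α₁ β₁   = ⇒-contrapose (t⇝⇒⇒ β₁ α₁)
    -- Globality puts `□` in front of `t⇝ α₁ β₁`; the induction hypothesis under `NecB`, with `K`
    -- twice, does the rest.
    ... | boxes α₁ β₁       =
      ⇒-trans (t⇝⇒□ α₁ β₁) (⇒-trans (MP (K _ _) (NecB (t⇝⇒⇒ α₁ β₁))) (K _ _))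
    ... | fresh _           =
      subst (λ x → ⊢ ((⊤' ⇝ (ψ ⇒ t β)) ⇒ x ⇒ t β)) (sym t-p)
        (⇒-discharge (A4 _ _) ⊤-intro)
    ... | other _ _         = A4 _ _

  ⊥⇝ : ∀ β → ⊢ t⇝ ⊥' β
  ⊥⇝ β = t⇝-elim ⊢_ {⊥'} {β} (λ _ _ → MP ∧-projˡ (A1 β)) (split-⊥ β)
    where
    split-⊥ : ∀ β → ⊢ split ⊥' β
    split-⊥ β with view ⊥' β
    ... | and-right _ β₁ β₂ = ∧-intro (⊥⇝ β₁) (⊥⇝ β₂)
    ... | other _ _         = MP ∧-projˡ (A1 _)

  ⇝⊤ : ∀ α → ⊢ t⇝ α ⊤'
  ⇝⊤ α = t⇝-elim ⊢_ {α} {⊤'} (λ _ _ → MP ∧-projʳ (A1 α)) (split-⊤ α)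
    where
    split-⊤ : ∀ α → ⊢ split α ⊤'
    split-⊤ α with view α ⊤'
    ... | or-left α₁ α₂ _ = ∧-intro (⇝⊤ α₁) (⇝⊤ α₂)
    ... | top _           = NecA ⊤-intro
    ... | fresh _         = NecA (⇒-const ⊤-intro)
    ... | other _ _       = MP ∧-projʳ (A1 _)

  -- If p occurs on the left, both sides coincide by the choice of `split`; if not, nothing is
  -- changed and `A2` applies. `¬⇝¬` and `□⇝□` divide in the same way.
  ∨⇝ : ∀ α α' β → ⊢ (t⇝ (α ∨' α') β ⇔ (t⇝ α β ∧' t⇝ α' β))
  ∨⇝ α α' β = t⇝-elim (λ x → ⊢ (x ⇔ (t⇝ α β ∧' t⇝ α' β))) {α ∨' α'} {β}
    (λ (a , a') b → subst₂ (λ x y → ⊢ (((α ∨' α') ⇝ β) ⇔ (x ∧' y)))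
      (sym (t⇝-free a b)) (sym (t⇝-free a' b)) (A2 α α' β))
    ⇔-refl

  ⇝∧ : ∀ α β β' → ⊢ (t⇝ α (β ∧' β') ⇔ (t⇝ α β ∧' t⇝ α β'))
  ⇝∧ α β β' = t⇝-elim (λ x → ⊢ (x ⇔ (t⇝ α β ∧' t⇝ α β'))) {α} {β ∧' β'}
    (λ a (b , b') → subst₂ (λ x y → ⊢ ((α ⇝ (β ∧' β')) ⇔ (x ∧' y)))
      (sym (t⇝-free a b)) (sym (t⇝-free a b')) (A3 α β β'))
    (split-∧ α)
    where
    split-∧ : ∀ α → ⊢ (split α (β ∧' β') ⇔ (t⇝ α β ∧' t⇝ α β'))
    -- The disjunction is split before the conjunction, so the four pieces must be regrouped.
    split-∧ (α ∨' α') =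
      ⇔-trans (∧-cong (⇝∧ α β β') (⇝∧ α' β β'))
        (⇔-trans ∧-interchange
          (∧-cong (⇔-sym (∨⇝ α α' β)) (⇔-sym (∨⇝ α α' β'))))
    -- `[∀]` stays unsplit, so `A3` itself is needed here.
    split-∧ ⊤' = subst₂ (λ x y → ⊢ (([∀] (t β ∧' t β')) ⇔ (x ∧' y)))
      (sym (t-[∀] β)) (sym (t-[∀] β')) (A3 ⊤' (t β) (t β'))
    split-∧ (var _)  = ⇔-refl
    split-∧ ⊥'       = ⇔-refl
    split-∧ (¬' _)   = ⇔-refl
    split-∧ (_ ∧' _) = ⇔-refl
    split-∧ (_ ⇒ _)  = ⇔-refl
    split-∧ (_ ⇔ _)  = ⇔-refl
    split-∧ (_ ⇝ _)  = ⇔-refl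
    split-∧ (□ _)    = ⇔-refl

  ¬⇝¬ : ∀ α β → ⊢ (t⇝ α β ⇔ t⇝ (¬' β) (¬' α))
  ¬⇝¬ α β = t⇝-elim (λ x → ⊢ (t⇝ α β ⇔ x)) {¬' β} {¬' α}
    (λ b a → subst (λ x → ⊢ (x ⇔ ((¬' β) ⇝ (¬' α)))) (sym (t⇝-free a b)) (A5 α β))
    ⇔-refl

  □⇝□ : ∀ α β → ⊢ (t⇝ α β ⇒ t⇝ (□ α) (□ β))
  □⇝□ α β = t⇝-elim (λ x → ⊢ (t⇝ α β ⇒ x)) {□ α} {□ β}
    (λ a b → subst (λ x → ⊢ (x ⇒ ((□ α) ⇝ (□ β)))) (sym (t⇝-free a b)) (Add α β))
    ⇒-refl

  t-⊢ : ∀ {α} → ⊢ α → ⊢ t α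
  t-⊢ (taut (τ , σ , v , refl)) = taut (τ , t ∘ σ , v , sym (t-inst σ τ))
  t-⊢ (A1 φ)     = ∧-intro (⊥⇝ φ) (⇝⊤ φ)
  t-⊢ (A2 φ χ θ) = ∨⇝ φ χ θ
  t-⊢ (A3 φ χ θ) = ⇝∧ φ χ θ
  t-⊢ (A4 φ χ)   = t⇝⇒⇒ φ χ
  t-⊢ (A5 φ χ)   = ¬⇝¬ φ χ
  t-⊢ (A8 φ)     rewrite t-[∀] ([∀] φ) | t-[∀] φ        = A8 (t φ)
  t-⊢ (A9 φ)     rewrite t-[∀] (¬' ([∀] φ)) | t-[∀] φ   = A9 (t φ)
  t-⊢ (A10 φ χ)  rewrite t-[∀] (φ ⇝ χ)                  = t⇝-global φ χ
  t-⊢ (A11 φ)    rewrite t⇝-¬⊥ ([∀] φ) | t-[∀] φ        = A11 (t φ)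
  t-⊢ (K φ χ)    = K (t φ) (t χ)
  t-⊢ (Add φ χ)  = □⇝□ φ χ
  t-⊢ (MP h k)   = MP (t-⊢ h) (t-⊢ k)
  t-⊢ (NecA {φ} h) rewrite t-[∀] φ = NecA (t-⊢ h)
  t-⊢ (NecB h)   = NecB (t-⊢ h)

  -- The conjuncts of the premise under translation

  -- Against `var p` only disjunctions in `φ` are split, as `A2` permits; every other `φ` without p
  -- gives `φ ⇝ ψ` itself.
  ⇝p : ∀ φ → p ∉v φ → ⊢ ((φ ⇝ ψ) ⇒ t⇝ φ (var p))
  ⇝p φ p∉φ = t⇝-elim (λ x → ⊢ ((φ ⇝ ψ) ⇒ x)) {φ} {var p}
    (λ _ p≢p → ⊥-elim (p≢p refl)) (split-p φ p∉φ)
    where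
    split-p : ∀ φ → p ∉v φ → ⊢ ((φ ⇝ ψ) ⇒ split φ (var p))
    split-p φ f with view φ (var p)
    split-p _ (f , f') | or-left φ₁ φ₂ _ = ⇒-trans (⇔-to (A2 φ₁ φ₂ ψ))
      (⇒-∧ (⇒-trans ∧-projˡ (⇝p φ₁ f)) (⇒-trans ∧-projʳ (⇝p φ₂ f')))
    split-p _ f | top _     rewrite t-p              = ⇒-refl
    split-p _ f | fresh _                            = ⊥-elim (f refl)
    split-p _ f | other α _ rewrite t-p | t-free α f = ⇒-refl

  -- `β` is split into conjuncts, each of which becomes `[∀]` of a provable implication from `ψ`.
  -- Taking `β` to be `ψ` or `var p` gives the last two conjuncts.
  p⇝ : ∀ β → ⊢ (ψ ⇒ t β) → ⊢ t⇝ (var p) β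
  p⇝ β ψ⇒β = t⇝-elim ⊢_ {var p} {β}
    (λ p≢p _ → ⊥-elim (p≢p refl)) (split-p β ψ⇒β)
    where
    split-p : ∀ β → ⊢ (ψ ⇒ t β) → ⊢ split (var p) β
    split-p (β ∧' β') h =
      ∧-intro (p⇝ β (⇒-trans h ∧-projˡ)) (p⇝ β' (⇒-trans h ∧-projʳ))
    -- Rewriting decides `p ≟ p`, so that `view` reduces to `fresh`.
    split-p (var _)  h rewrite ≟-diag {p} refl = NecA h
    split-p ⊤'       h rewrite ≟-diag {p} refl = NecA h
    split-p ⊥'       h rewrite ≟-diag {p} refl = NecA h
    split-p (¬' _)   h rewrite ≟-diag {p} refl = NecA h
    split-p (_ ∨' _) h rewrite ≟-diag {p} refl = NecA h
    split-p (_ ⇒ _)  h rewrite ≟-diag {p} refl = NecA h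
    split-p (_ ⇔ _)  h rewrite ≟-diag {p} refl = NecA h
    split-p (_ ⇝ _)  h rewrite ≟-diag {p} refl = NecA h
    split-p (□ _)    h rewrite ≟-diag {p} refl = NecA h

theorem4p16 : (φ ψ χ : Form) (p : ℕ) → p ∉v φ → p ∉v ψ → p ∉v χ →
    ⊢ (((φ ⇝ var p) ∧' (var p ⇝ ψ) ∧' (var p ⇝ var p)) ⇒ χ) →
    ⊢ ((φ ⇝ ψ) ⇒ χ)
theorem4p16 φ ψ χ p p∉φ p∉ψ p∉χ h =
  -- `φ ⇝ ψ` implies the translated antecedent, and the translated premise leads from there to
  -- `t χ`, which is `χ`.
  ⇒-trans (⇒-∧ (⇝p φ p∉φ) (⇒-const (∧-intro p⇝ψ p⇝p)))
    (subst (λ x → ⊢ ((t⇝ φ (var p) ∧' t⇝ (var p) ψ ∧' t⇝ (var p) (var p)) ⇒ x))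
      (t-free χ p∉χ) (t-⊢ h))
  where
  open Translation p ψ
  p⇝ψ : ⊢ t⇝ (var p) ψ
  p⇝ψ = p⇝ ψ (subst (λ x → ⊢ (ψ ⇒ x)) (sym (t-free ψ p∉ψ)) ⇒-refl)
  p⇝p : ⊢ t⇝ (var p) (var p)
  p⇝p = p⇝ (var p) (subst (λ x → ⊢ (ψ ⇒ x)) (sym t-p) ⇒-refl)
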